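{- For the fixed-base-$b$ Cooley–Tukey DAG of length $N$ executed on $p$ processors under the no-recomputation assumption, $$W_{\max}=\Omega\!\left(\frac Np\log N\right).$$
   Context: $b=2^t$ with $t=O(1)$ is a fixed radix, $N$ is a power of $b$, and $p\ge2$ is the number of processors. The fixed-base-$b$ Cooley–Tukey DAG is the computation DAG of the radix-$b$ Cooley–Tukey FFT; expanding each radix-$b$ butterfly into its $t$ constituent radix-2 layers gives the standard radix-2 FFT DAG on $N$ inputs, which has $\log_2N+1$ levels of $N$ vertices and $N\log_2N$ noninput (arithmetic) vertices. No recomputation: every arithmetic vertex is executed exactly once, on some processor. $W_{\max}$ is the maximum over processors of the local work, each execution of an arithmetic vertex costing at least a constant amount of work.
   Formalization: The amounts of work (the cost of each execution of an arithmetic vertex, its constant lower bound, and any additional local work) are taken to be rational numbers rather than real numbers. -}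

module Defs where

open import Algebra.Properties.CommutativeMonoid.Sum using (sum)
open import Data.Bool using (if_then_else_)
open import Data.Fin as Fin using (Fin; toℕ; inject₁; combine; finToFun)
open import Data.Fin.Properties as Fin using (toℕ-inject₁)
open import Data.List using (tabulate)
open import Data.List.Extrema as Extrema using ()
open import Data.Nat using (ℕ; suc; _*_; _^_; _<_; s≤s)
open import Data.Nat.Properties using (≤-reflexive; <-trans; <-irrefl)
open import Data.Product using (_×_; _,_; proj₁; ∃-syntax; ∃!)
open import Data.Rational as ℚ using (ℚ; 0ℚ)
open import Data.Rational.Properties using (+-0-commutativeMonoid; ≤-decTotalOrder)
open import Relation.Binary using (module DecTotalOrder)
open import Relation.Binary.Construct.Closure.Transitive using (TransClosure; [_]; _∷_)
open import Relation.Binary.PropositionalEquality using (_≡_; _≢_; refl)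
open import Relation.Nullary using (¬_; does)

record Dag : Set₁ where
  field
    Vertex  : Set
    _⟶_     : Vertex → Vertex → Set
    acyclic : ∀ {v} → ¬ TransClosure _⟶_ v v

  -- The inputs are the sources; every other vertex computes a value from
  -- its predecessors.
  Arithmetic : Vertex → Set
  Arithmetic v = ∃[ u ] u ⟶ v

-- The radix-(2 ^ t) Cooley–Tukey FFT of length N = (2 ^ t) ^ k has k stages.
-- `finToFun x : Fin k → Fin (2 ^ t)` lists the base-(2 ^ t) digits of an index
-- x, and `finToFun` of a digit lists its t bits (most significant first in
-- both cases, i.e. the decimation-in-frequency order).
module _ (t k : ℕ) where

  Index : Set
  Index = Fin ((2 ^ t) ^ k)

  digit : Index → Fin k → Fin (2 ^ t)
  digit = finToFun

  bit : Index → Fin k → Fin t → Fin 2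
  bit x s = finToFun (digit x s)

  -- A radix-(2 ^ t) butterfly of stage s acts on the 2 ^ t indices that agree
  -- in every digit other than digit s.
  SameButterfly : Fin k → Index → Index → Set
  SameButterfly s x y = ∀ s′ → s′ ≢ s → digit x s′ ≡ digit y s′

  -- The j-th radix-2 layer inside such a butterfly combines the two indices
  -- that differ in bit j of digit s.
  SamePair : Fin k → Fin t → Index → Index → Set
  SamePair s j x y =
    SameButterfly s x y × (∀ j′ → j′ ≢ j → bit x s j′ ≡ bit y s j′)

  -- Level 0 holds the inputs; layer j of stage s is layer number
  -- combine s j = s * t + j and leads from that level to the next one.
  LevelVertex : Set
  LevelVertex = Fin (suc (k * t)) × Index

  data _⟶ᶠ_ : LevelVertex → LevelVertex → Set where
    layer : ∀ (s : Fin k) (j : Fin t) {x y : Index} → SamePair s j x y →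
            (inject₁ (combine s j) , x) ⟶ᶠ (Fin.suc (combine s j) , y)

  private
    level-< : ∀ {u v} → u ⟶ᶠ v → toℕ (proj₁ u) < toℕ (proj₁ v)
    level-< (layer s j _) = s≤s (≤-reflexive (toℕ-inject₁ (combine s j)))

    level-<⁺ : ∀ {u v} → TransClosure _⟶ᶠ_ u v → toℕ (proj₁ u) < toℕ (proj₁ v)
    level-<⁺ [ e ]   = level-< e
    level-<⁺ (e ∷ p) = <-trans (level-< e) (level-<⁺ p)

  cooleyTukey : Dag
  cooleyTukey = record
    { Vertex  = LevelVertex
    ; _⟶_     = _⟶ᶠ_
    ; acyclic = λ p → <-irrefl refl (level-<⁺ p)
    }

-- An execution on p processors is a finite family of events, each of which
-- computes one arithmetic vertex on one processor.  A vertex may be computed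
-- by several events; NoRecomputation below excludes this.
record Execution (G : Dag) (p : ℕ) : Set where
  open Dag G
  field
    size       : ℕ
    vertex     : Fin size → Vertex
    arithmetic : ∀ e → Arithmetic (vertex e)
    processor  : Fin size → Fin p
    time       : Fin size → ℕ
    respects   : ∀ e {u} → u ⟶ vertex e → Arithmetic u →
                 ∃[ e′ ] vertex e′ ≡ u × time e′ < time e

    cost       : Fin size → ℚ
    cost≥0     : ∀ e → 0ℚ ℚ.≤ cost e
    -- Local work other than the computation of vertices (e.g. index arithmetic).
    overhead   : Fin p → ℚ
    overhead≥0 : ∀ P → 0ℚ ℚ.≤ overhead P

  NoRecomputation : Set
  NoRecomputation = ∀ v → Arithmetic v → ∃! _≡_ λ e → vertex e ≡ v

  localWork : Fin p → ℚ
  localWork P = overhead P ℚ.+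
    sum +-0-commutativeMonoid
      (λ e → if does (processor e Fin.≟ P) then cost e else 0ℚ)

  -- Local work is nonnegative, so the default value 0 does not affect the
  -- maximum when p ≥ 1.
  Wmax : ℚ
  Wmax = Extrema.max (DecTotalOrder.totalOrder ≤-decTotalOrder) 0ℚ
           (tabulate localWork)

{-# OPTIONS --safe #-}
module Submission where

-- The DAG has N * log₂ N arithmetic vertices: each of its k * t layers leads
-- to N of them, and N = 2 ^ (t * k).  An execution must contain an event for
-- each, and different vertices need different events, so there are at least
-- N * log₂ N events (`arithmeticVertices≤size`).  Each event is charged to
-- exactly one processor, so the local works of the p processors add up to at
-- least the total cost of the events (`totalCost≤∑localWork`), which is at
-- least w₀ * N * log₂ N.  The largest of p numbers is at least their average,
-- so the constant c = w₀ works for every N, that is, with N₀ = 0.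

open import Defs
open import Algebra.Properties.CommutativeMonoid.Sum
  using (sum-syntax; sum-cong-≗; sum-replicate-zero; ∑-comm)
open import Data.Bool using (if_then_else_)
open import Data.Fin as Fin using (Fin; combine; remQuot)
open import Data.Fin.Properties using (combine-surjective; combine-remQuot; injective⇒≤)
open import Data.Integer as ℤ using (+_)
import Data.Integer.Properties as ℤ
open import Data.List using (tabulate)
open import Data.List.Extrema using (xs≤max)
open import Data.List.Relation.Unary.All.Properties using (tabulate⁻)
open import Data.Nat as ℕ using (ℕ; zero; suc; NonZero; _^_; _≤_)
open import Data.Nat.Logarithm using (⌊log₂_⌋; ⌊log₂[2^n]⌋≡n)
import Data.Nat.Properties as ℕ
open import Data.Product using (_×_; _,_; proj₁; proj₂; ∃-syntax; uncurry)
open import Data.Rational as ℚ using (ℚ; 0ℚ; 1ℚ; _/_; fromℚᵘ)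
import Data.Rational.Properties as ℚ
open import Data.Rational.Unnormalised as ℚᵘ using (mkℚᵘ; *≡*; *≤*)
import Data.Rational.Unnormalised.Properties as ℚᵘ
open import Relation.Binary using (module DecTotalOrder)
open import Relation.Binary.PropositionalEquality
  using (_≡_; refl; sym; trans; cong; cong₂; module ≡-Reasoning)
open import Relation.Nullary using (does)

-- Rational arithmetic with integer numerators

-- Identities between fractions i / n reduce through these two homomorphisms
-- to cross-multiplied identities of integers.
fromℚᵘ-homo-+ : ∀ x y → fromℚᵘ x ℚ.+ fromℚᵘ y ≡ fromℚᵘ (x ℚᵘ.+ y)
fromℚᵘ-homo-+ x y = ℚ.toℚᵘ-injective (begin
  ℚ.toℚᵘ (fromℚᵘ x ℚ.+ fromℚᵘ y)                 ≈⟨ ℚ.toℚᵘ-homo-+ (fromℚᵘ x) (fromℚᵘ y) ⟩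
  ℚ.toℚᵘ (fromℚᵘ x) ℚᵘ.+ ℚ.toℚᵘ (fromℚᵘ y)       ≈⟨ ℚᵘ.+-cong (ℚ.toℚᵘ-fromℚᵘ x) (ℚ.toℚᵘ-fromℚᵘ y) ⟩
  x ℚᵘ.+ y                                       ≈⟨ ℚ.toℚᵘ-fromℚᵘ (x ℚᵘ.+ y) ⟨
  ℚ.toℚᵘ (fromℚᵘ (x ℚᵘ.+ y))                     ∎)
  where open import Relation.Binary.Reasoning.Setoid ℚᵘ.≃-setoid

fromℚᵘ-homo-* : ∀ x y → fromℚᵘ x ℚ.* fromℚᵘ y ≡ fromℚᵘ (x ℚᵘ.* y)
fromℚᵘ-homo-* x y = ℚ.toℚᵘ-injective (begin
  ℚ.toℚᵘ (fromℚᵘ x ℚ.* fromℚᵘ y)                 ≈⟨ ℚ.toℚᵘ-homo-* (fromℚᵘ x) (fromℚᵘ y) ⟩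
  ℚ.toℚᵘ (fromℚᵘ x) ℚᵘ.* ℚ.toℚᵘ (fromℚᵘ y)       ≈⟨ ℚᵘ.*-cong (ℚ.toℚᵘ-fromℚᵘ x) (ℚ.toℚᵘ-fromℚᵘ y) ⟩
  x ℚᵘ.* y                                       ≈⟨ ℚ.toℚᵘ-fromℚᵘ (x ℚᵘ.* y) ⟨
  ℚ.toℚᵘ (fromℚᵘ (x ℚᵘ.* y))                     ∎)
  where open import Relation.Binary.Reasoning.Setoid ℚᵘ.≃-setoid

fromℚᵘ-mono-≤ : ∀ {x y} → x ℚᵘ.≤ y → fromℚᵘ x ℚ.≤ fromℚᵘ y
fromℚᵘ-mono-≤ {x} {y} x≤y = ℚ.toℚᵘ-cancel-≤
  (ℚᵘ.≤-respˡ-≃ (ℚᵘ.≃-sym (ℚ.toℚᵘ-fromℚᵘ x))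
    (ℚᵘ.≤-respʳ-≃ (ℚᵘ.≃-sym (ℚ.toℚᵘ-fromℚᵘ y)) x≤y))

-- The embedding of the natural numbers into the rationals.
ι : ℕ → ℚ
ι n = + n / 1

ι-suc : ∀ n → ι (suc n) ≡ 1ℚ ℚ.+ ι n
ι-suc n = sym (trans (fromℚᵘ-homo-+ (mkℚᵘ (+ 1) 0) (mkℚᵘ (+ n) 0))
  (cong (λ m → (+ 1 ℤ.+ m) / 1) (ℤ.*-identityʳ (+ n))))

ι-homo-* : ∀ m n → ι m ℚ.* ι n ≡ ι (m ℕ.* n)
ι-homo-* m n = trans (fromℚᵘ-homo-* (mkℚᵘ (+ m) 0) (mkℚᵘ (+ n) 0))
  (cong (_/ 1) (sym (ℤ.pos-* m n)))

ι-mono-≤ : ∀ {m n} → m ≤ n → ι m ℚ.≤ ι n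
ι-mono-≤ {m} {n} m≤n = fromℚᵘ-mono-≤ {mkℚᵘ (+ m) 0} {mkℚᵘ (+ n) 0}
  (*≤* (ℤ.*-monoʳ-≤-nonNeg (+ 1) (ℤ.+≤+ m≤n)))

/-*-cancel : ∀ m n .{{_ : NonZero n}} → (+ m / n) ℚ.* ι n ≡ ι m
/-*-cancel m (suc n) = trans (fromℚᵘ-homo-* (mkℚᵘ (+ m) n) (mkℚᵘ (+ suc n) 0))
  (ℚ.fromℚᵘ-cong {mkℚᵘ (+ m) n ℚᵘ.* mkℚᵘ (+ suc n) 0} {mkℚᵘ (+ m) 0}
    (*≡* (ℤ.*-assoc (+ m) (+ suc n) (+ 1))))

-- Finite sums of rationals

∑ : ∀ n → (Fin n → ℚ) → ℚ
∑ = sum-syntax ℚ.+-0-commutativeMonoid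

∑-mono-≤ : ∀ n {f g : Fin n → ℚ} → (∀ i → f i ℚ.≤ g i) → ∑ n f ℚ.≤ ∑ n g
∑-mono-≤ zero    f≤g = ℚ.≤-refl
∑-mono-≤ (suc n) f≤g =
  ℚ.+-mono-≤ (f≤g Fin.zero) (∑-mono-≤ n (λ i → f≤g (Fin.suc i)))

∑-const : ∀ n w → ∑ n (λ _ → w) ≡ ι n ℚ.* w
∑-const zero    w = sym (ℚ.*-zeroˡ w)
∑-const (suc n) w = begin
  w ℚ.+ ∑ n (λ _ → w)           ≡⟨ cong₂ ℚ._+_ (sym (ℚ.*-identityˡ w)) (∑-const n w) ⟩
  1ℚ ℚ.* w ℚ.+ ι n ℚ.* w        ≡⟨ ℚ.*-distribʳ-+ w 1ℚ (ι n) ⟨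
  (1ℚ ℚ.+ ι n) ℚ.* w            ≡⟨ cong (ℚ._* w) (ι-suc n) ⟨
  ι (suc n) ℚ.* w               ∎
  where open ≡-Reasoning

-- A sum whose only nonzero term is at index i.
∑-indicator : ∀ {n} (i : Fin n) w →
              ∑ n (λ j → if does (i Fin.≟ j) then w else 0ℚ) ≡ w
∑-indicator {suc n} Fin.zero w = trans
  (cong (w ℚ.+_) (sum-replicate-zero ℚ.+-0-commutativeMonoid n))
  (ℚ.+-identityʳ w)
∑-indicator (Fin.suc i) w = trans (ℚ.+-identityˡ _) (∑-indicator i w)

-- Counting the arithmetic vertices

module _ (t k : ℕ) where

  open Dag (cooleyTukey t k)

  -- In each radix-2 layer an index is paired in particular with itself, so
  -- the vertex at the upper end of a layer always has a predecessor.
  noninput-arithmetic : ∀ (l : Fin (k ℕ.* t)) x → Arithmetic (Fin.suc l , x)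
  noninput-arithmetic l x with combine-surjective {k} {t} l
  ... | s , j , refl = _ , layer s j ((λ _ _ → refl) , (λ _ _ → refl))

  -- Sending an arithmetic vertex to an event that computes it is injective,
  -- since an event computes only one vertex.
  arithmeticVertices≤size : ∀ {p} (E : Execution (cooleyTukey t k) p) →
    Execution.NoRecomputation E →
    (k ℕ.* t) ℕ.* (2 ^ t) ^ k ≤ Execution.size E
  arithmeticVertices≤size E once = injective⇒≤ {f = event} event-injective
    where
    open Execution E
    N = (2 ^ t) ^ k

    vertexAt : Fin ((k ℕ.* t) ℕ.* N) → Fin (k ℕ.* t) × Fin N
    vertexAt = remQuot {k ℕ.* t} N

    eventOf : ∀ ((l , x) : Fin (k ℕ.* t) × Fin N) → ∃[ e ] vertex e ≡ (Fin.suc l , x)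
    eventOf (l , x) = let e , computes , _ = once _ (noninput-arithmetic l x) in e , computes

    event : Fin ((k ℕ.* t) ℕ.* N) → Fin size
    event i = proj₁ (eventOf (vertexAt i))

    eventOf-injective : ∀ u v → proj₁ (eventOf u) ≡ proj₁ (eventOf v) → u ≡ v
    eventOf-injective u v eq = drop-suc (begin
      (Fin.suc (proj₁ u) , proj₂ u)    ≡⟨ proj₂ (eventOf u) ⟨
      vertex (proj₁ (eventOf u))       ≡⟨ cong vertex eq ⟩
      vertex (proj₁ (eventOf v))       ≡⟨ proj₂ (eventOf v) ⟩
      (Fin.suc (proj₁ v) , proj₂ v)    ∎)
      where
      open ≡-Reasoning
      drop-suc : ∀ {l l′ : Fin (k ℕ.* t)} {x x′ : Fin N} →
                 _≡_ {A = LevelVertex t k} (Fin.suc l , x) (Fin.suc l′ , x′) →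
                 (l , x) ≡ (l′ , x′)
      drop-suc refl = refl

    event-injective : ∀ {i j} → event i ≡ event j → i ≡ j
    event-injective {i} {j} eq = begin
      i                               ≡⟨ combine-remQuot {k ℕ.* t} N i ⟨
      uncurry combine (vertexAt i)    ≡⟨ cong (uncurry combine) (eventOf-injective (vertexAt i) (vertexAt j) eq) ⟩
      uncurry combine (vertexAt j)    ≡⟨ combine-remQuot {k ℕ.* t} N j ⟩
      j                               ∎
      where open ≡-Reasoning

  ⌊log₂N⌋≡k*t : ⌊log₂ (2 ^ t) ^ k ⌋ ≡ k ℕ.* t
  ⌊log₂N⌋≡k*t = begin
    ⌊log₂ (2 ^ t) ^ k ⌋    ≡⟨ cong ⌊log₂_⌋ (ℕ.^-*-assoc 2 t k) ⟩
    ⌊log₂ 2 ^ (t ℕ.* k) ⌋  ≡⟨ ⌊log₂[2^n]⌋≡n (t ℕ.* k) ⟩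
    t ℕ.* k                ≡⟨ ℕ.*-comm t k ⟩
    k ℕ.* t                ∎
    where open ≡-Reasoning

-- Total and maximal work of an execution

module _ {G : Dag} {p : ℕ} (E : Execution G p) where

  open Execution E

  -- Exchanging the two summations charges each event to its processor.
  totalCost≤∑localWork : ∑ size cost ℚ.≤ ∑ p localWork
  totalCost≤∑localWork = begin
    ∑ size cost                             ≡⟨ sum-cong-≗ ℚ.+-0-commutativeMonoid
                                                 (λ e → ∑-indicator (processor e) (cost e)) ⟨
    ∑ size (λ e → ∑ p (λ P → share P e))    ≡⟨ ∑-comm ℚ.+-0-commutativeMonoid (λ e P → share P e) ⟩
    ∑ p (λ P → ∑ size (share P))            ≤⟨ ∑-mono-≤ p share≤localWork ⟩
    ∑ p localWork                           ∎
    where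
    open ℚ.≤-Reasoning
    share : Fin p → Fin size → ℚ
    share P e = if does (processor e Fin.≟ P) then cost e else 0ℚ

    share≤localWork : ∀ P → ∑ size (share P) ℚ.≤ localWork P
    share≤localWork P = begin
      ∑ size (share P)            ≡⟨ ℚ.+-identityˡ _ ⟨
      0ℚ ℚ.+ ∑ size (share P)     ≤⟨ ℚ.+-monoˡ-≤ (∑ size (share P)) (overhead≥0 P) ⟩
      localWork P                 ∎

  localWork≤Wmax : ∀ P → localWork P ℚ.≤ Wmax
  localWork≤Wmax =
    tabulate⁻ (xs≤max (DecTotalOrder.totalOrder ℚ.≤-decTotalOrder) 0ℚ (tabulate localWork))

  size*w≤p*Wmax : ∀ {w} → (∀ e → w ℚ.≤ cost e) → ι size ℚ.* w ℚ.≤ ι p ℚ.* Wmax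
  size*w≤p*Wmax {w} w≤cost = begin
    ι size ℚ.* w            ≡⟨ ∑-const size w ⟨
    ∑ size (λ _ → w)        ≤⟨ ∑-mono-≤ size w≤cost ⟩
    ∑ size cost             ≤⟨ totalCost≤∑localWork ⟩
    ∑ p localWork           ≤⟨ ∑-mono-≤ p localWork≤Wmax ⟩
    ∑ p (λ _ → Wmax)        ≡⟨ ∑-const p Wmax ⟩
    ι p ℚ.* Wmax            ∎
    where open ℚ.≤-Reasoning

-- Clearing the denominator p of the claimed bound.
clear-denominator : ∀ w N p L .{{_ : NonZero p}} →
  ι p ℚ.* (w ℚ.* ((+ N / p) ℚ.* ι L)) ≡ ι (L ℕ.* N) ℚ.* w
clear-denominator w N p L = begin
  ι p ℚ.* (w ℚ.* (N/p ℚ.* ι L))      ≡⟨ ℚ.*-comm (ι p) _ ⟩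
  (w ℚ.* (N/p ℚ.* ι L)) ℚ.* ι p      ≡⟨ ℚ.*-assoc w (N/p ℚ.* ι L) (ι p) ⟩
  w ℚ.* ((N/p ℚ.* ι L) ℚ.* ι p)      ≡⟨ cong (λ q → w ℚ.* (q ℚ.* ι p)) (ℚ.*-comm N/p (ι L)) ⟩
  w ℚ.* ((ι L ℚ.* N/p) ℚ.* ι p)      ≡⟨ cong (w ℚ.*_) (ℚ.*-assoc (ι L) N/p (ι p)) ⟩
  w ℚ.* (ι L ℚ.* (N/p ℚ.* ι p))      ≡⟨ cong (λ q → w ℚ.* (ι L ℚ.* q)) (/-*-cancel N p) ⟩
  w ℚ.* (ι L ℚ.* ι N)                ≡⟨ cong (w ℚ.*_) (ι-homo-* L N) ⟩
  w ℚ.* ι (L ℕ.* N)                  ≡⟨ ℚ.*-comm w _ ⟩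
  ι (L ℕ.* N) ℚ.* w                  ∎
  where
  open ≡-Reasoning
  N/p : ℚ
  N/p = + N / p

proposition5 : ∀ (t : ℕ) .{{_ : NonZero t}} (w₀ : ℚ) → 0ℚ ℚ.< w₀ →
    ∃[ c ] 0ℚ ℚ.< c × ∃[ N₀ ]
    (∀ (k p : ℕ) .{{_ : NonZero p}} → 2 ≤ p →
    let N = (2 ^ t) ^ k in N₀ ≤ N →
    (E : Execution (cooleyTukey t k) p) →
    Execution.NoRecomputation E →
    (∀ e → w₀ ℚ.≤ Execution.cost E e) →
    c ℚ.* ((+ N / p) ℚ.* (+ ⌊log₂ N ⌋ / 1)) ℚ.≤ Execution.Wmax E)
proposition5 t w₀ w₀>0 = w₀ , w₀>0 , 0 , bound
  where
  bound : ∀ (k p : ℕ) .{{_ : NonZero p}} → 2 ≤ p →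
    let N = (2 ^ t) ^ k in 0 ≤ N →
    (E : Execution (cooleyTukey t k) p) →
    Execution.NoRecomputation E →
    (∀ e → w₀ ℚ.≤ Execution.cost E e) →
    w₀ ℚ.* ((+ N / p) ℚ.* (+ ⌊log₂ N ⌋ / 1)) ℚ.≤ Execution.Wmax E
  bound k p _ _ E once w₀≤cost =
    ℚ.*-cancelˡ-≤-pos (ι p) {{ℚ.normalize-pos p 1}} (begin
      ι p ℚ.* (w₀ ℚ.* ((+ N / p) ℚ.* ι ⌊log₂ N ⌋))  ≡⟨ clear-denominator w₀ N p ⌊log₂ N ⌋ ⟩
      ι (⌊log₂ N ⌋ ℕ.* N) ℚ.* w₀                    ≡⟨ cong (λ L → ι (L ℕ.* N) ℚ.* w₀) (⌊log₂N⌋≡k*t t k) ⟩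
      ι ((k ℕ.* t) ℕ.* N) ℚ.* w₀                    ≤⟨ ℚ.*-monoʳ-≤-nonNeg w₀ {{w₀≥0}}
                                                         (ι-mono-≤ (arithmeticVertices≤size t k E once)) ⟩
      ι (Execution.size E) ℚ.* w₀                   ≤⟨ size*w≤p*Wmax E w₀≤cost ⟩
      ι p ℚ.* Execution.Wmax E                      ∎)
    where
    open ℚ.≤-Reasoning
    N = (2 ^ t) ^ k
    w₀≥0 = ℚ.nonNegative (ℚ.<⇒≤ w₀>0)
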